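{- Let $n$ be a nonnegative integer. For any complex number $x$ we have (i) $\displaystyle\sum_{k=0}^{[n/2]}\binom n{2k}U_{2k}\left((x-1)^{n-2k}-x^{n-2k}+(x+1)^{n-2k}\right)=x^n$; (ii) $\displaystyle\sum_{k=0}^{[n/2]}\binom n{2k}U_{2k}\left(x^{n-2k}+(x+3)^{n-2k}\right)=(x+1)^n+(x+2)^n$; (iii) $\displaystyle\sum_{k=0}^{[n/2]}\binom n{2k}U_{2k}\left((x+3)^{n-2k}-(x-3)^{n-2k}\right)=(x+2)^n+(x+1)^n-(x-1)^n-(x-2)^n$.
   Context: $[x]$ is the greatest integer not exceeding $x$. The sequence $\{U_n\}_{n\ge0}$ is defined by $U_0=1$ and $U_n=-2\sum_{k=1}^{[n/2]}\binom n{2k}U_{n-2k}$ for $n\ge1$. The convention $0^0=1$ is used. -}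

module Defs where

open import Algebra.Bundles using (CommutativeRing)
open import Data.Fin.Base using (toℕ)
open import Data.Integer.Base as ℤ using (ℤ; +_; -[1+_]; 1ℤ)
open import Data.Integer.Properties using (+-0-monoid)
open import Data.Nat.Base as ℕ using (ℕ; zero; suc; ⌊_/2⌋; s≤s)
open import Data.Nat.Combinatorics using (_C_)
open import Data.Nat.Induction using (<-Rec; <-rec; <-wellFounded)
open import Data.Nat.Properties using (m∸n≤m)
open import Induction.WellFounded using (module FixPoint)
open import Relation.Binary.PropositionalEquality using (_≡_; refl; cong)

open import Algebra.Properties.Monoid.Sum +-0-monoid using (sum-syntax; sum-cong-≗)

descent : ∀ m k → suc m ℕ.∸ 2 ℕ.* suc k ℕ.< suc m
descent m k = s≤s (m∸n≤m m (k ℕ.+ 1 ℕ.* suc k))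

-- The sum over 1 ≤ k ≤ ⌊n/2⌋ is indexed by i = k - 1.
U-step : ∀ n → <-Rec (λ _ → ℤ) n → ℤ
U-step zero      _ = 1ℤ
U-step n@(suc m) u =
  ℤ.- (+ 2) ℤ.*
    (∑[ i < ⌊ n /2⌋ ]
      (+ (n C (2 ℕ.* suc (toℕ i))) ℤ.* u (descent m (toℕ i))))

U : ℕ → ℤ
U = <-rec (λ _ → ℤ) U-step

U-zero : U 0 ≡ 1ℤ
U-zero = refl

U-suc : ∀ m → let n = suc m in
        U n ≡ ℤ.- (+ 2) ℤ.*
          (∑[ i < ⌊ n /2⌋ ]
            (+ (n C (2 ℕ.* suc (toℕ i))) ℤ.* U (n ℕ.∸ 2 ℕ.* suc (toℕ i))))
U-suc m = FixPoint.unfold-wfRec <-wellFounded (λ _ → ℤ) U-step ext {suc m}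
  where
  ext : ∀ n {u v : <-Rec (λ _ → ℤ) n} →
        (∀ {k} k<n → u {k} k<n ≡ v k<n) → U-step n u ≡ U-step n v
  ext zero      _   = refl
  ext n@(suc m) u≗v = cong (ℤ.- (+ 2) ℤ.*_) (sum-cong-≗ {⌊ n /2⌋} λ i →
    cong (+ (n C (2 ℕ.* suc (toℕ i))) ℤ.*_) (u≗v (descent m (toℕ i))))

-- The library has no complex numbers, so x ranges over an arbitrary commutative
-- ring, of which ℂ is an instance; rational integers enter through the
-- canonical map ℤ → R. Note x ^ 0 is 1# for every x, including 0#.
module InRing {c ℓ} (R : CommutativeRing c ℓ) where

  open CommutativeRing R
  open import Algebra.Properties.Semiring.Exp semiring public using (_^_)
  open import Algebra.Properties.Semiring.Mult semiring using (_×_)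
  open import Algebra.Properties.Semiring.Sum semiring public using (sum⁺-syntax)

  fromℕ : ℕ → Carrier
  fromℕ n = n × 1#

  fromℤ : ℤ → Carrier
  fromℤ (+ n)    = fromℕ n
  fromℤ -[1+ n ] = - fromℕ (suc n)

{-# OPTIONS --safe #-}

-- Write F y = Σ C(n,2k) U₂ₖ y^(n-2k). As U vanishes at odd indices, this is the n-th
-- term of the binomial convolution of U with the powers of y. The recursion for U says
-- that U ⋆ ((-1)^m + 1^m) = 0^m + U; convolving with the powers of x turns this into
-- F (x - 1) + F (x + 1) = x^n + F x, which is (i). Adding its instances at x + 1 and
-- x + 2 gives (ii), and subtracting (ii) at x - 3 from (ii) at x gives (iii).
module Submission where

open import Defs
open import Algebra.Bundles using (CommutativeRing)
open import Data.Fin.Base using (toℕ)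
open import Data.Fin.Properties using (toℕ<n)
open import Data.Integer.Base as ℤ using (ℤ; +_; -[1+_]; 0ℤ)
import Data.Integer.Properties as ℤ
open import Data.Nat.Base as ℕ using (ℕ; zero; suc; s≤s; ⌊_/2⌋)
open import Data.Nat.Combinatorics using (_C_; nCk+nC[k+1]≡[n+1]C[k+1])
open import Data.Nat.Combinatorics.Specification using (k>n⇒nCk≡0)
open import Data.Nat.Induction using (<-rec)
import Data.Nat.Properties as ℕ
open import Data.Product.Base using (_×_; _,_)
open import Function.Base using (_∘_)
open import Relation.Binary.PropositionalEquality as ≡ using (_≡_; cong)

import Algebra.Properties.AbelianGroup
import Algebra.Properties.Group
import Algebra.Properties.Ring
import Algebra.Properties.Monoid.Sum ℤ.+-0-monoid as ℤΣ
import Algebra.Properties.Semiring.Mult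
import Algebra.Properties.Semiring.Sum
import Algebra.Solver.CommutativeMonoid
import Relation.Binary.Reasoning.Setoid

-- Vanishing of `U` at odd indices.

2*suc : ∀ k → 2 ℕ.* suc k ≡ suc (suc (2 ℕ.* k))
2*suc = ℕ.*-suc 2

⌊1+2k/2⌋≡k : ∀ k → ⌊ suc (2 ℕ.* k) /2⌋ ≡ k
⌊1+2k/2⌋≡k zero    = ≡.refl
⌊1+2k/2⌋≡k (suc k) = ≡.trans (cong (⌊_/2⌋ ∘ suc) (2*suc k)) (cong suc (⌊1+2k/2⌋≡k k))

odd∸even : ∀ {j k} → j ℕ.≤ k → suc (2 ℕ.* k) ℕ.∸ 2 ℕ.* j ≡ suc (2 ℕ.* (k ℕ.∸ j))
odd∸even {j} {k} j≤k = ≡.trans (ℕ.+-∸-assoc 1 (ℕ.*-monoʳ-≤ 2 j≤k))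
  (cong suc (≡.sym (ℕ.*-distribˡ-∸ 2 k j)))

-- Subtracting an even number keeps the index odd, so the recursion refers only to smaller odd
-- indices and strong induction makes every term zero. For k = 0 the sum is empty.
U-odd : ∀ k → U (suc (2 ℕ.* k)) ≡ 0ℤ
U-odd = <-rec (λ k → U (suc (2 ℕ.* k)) ≡ 0ℤ) step
  where
  step : ∀ k → (∀ {j} → j ℕ.< k → U (suc (2 ℕ.* j)) ≡ 0ℤ) → U (suc (2 ℕ.* k)) ≡ 0ℤ
  step k rec = ≡.trans (U-suc (2 ℕ.* k)) (cong (ℤ.- (+ 2) ℤ.*_)
    (≡.trans (ℤΣ.sum-cong-≗ {m} vanish) (ℤΣ.sum-replicate-zero m)))
    where
    m = ⌊ suc (2 ℕ.* k) /2⌋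
    vanish : ∀ i → + (suc (2 ℕ.* k) C (2 ℕ.* suc (toℕ i))) ℤ.* U (suc (2 ℕ.* k) ℕ.∸ 2 ℕ.* suc (toℕ i)) ≡ 0ℤ
    vanish i = ≡.trans
      (cong (+ c ℤ.*_) (≡.trans (cong U (odd∸even i<k)) (rec (ℕ.∸-monoʳ-< (s≤s ℕ.z≤n) i<k))))
      (ℤ.*-zeroʳ (+ c))
      where
      c = suc (2 ℕ.* k) C (2 ℕ.* suc (toℕ i))
      -- The sum has exactly k terms, hence 2(i + 1) ≤ 2k and the subtraction is not truncated.
      i<k : toℕ i ℕ.< k
      i<k = ≡.subst (toℕ i ℕ.<_) (⌊1+2k/2⌋≡k k) (toℕ<n i)

module _ {c ℓ} (R : CommutativeRing c ℓ) where

  open CommutativeRing R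
  open InRing R
  open Algebra.Properties.AbelianGroup +-abelianGroup using (⁻¹-∙-comm)
  open Algebra.Properties.Group +-group
    using (ε⁻¹≈ε; ⁻¹-anti-homo-∙; ⁻¹-involutive; //-rightDividesʳ; //-rightDividesˡ)
    renaming (∙-cancelʳ to +-cancelʳ)
  open Algebra.Properties.Ring ring using (-‿distribʳ-*; -1*x≈-x)
  open Algebra.Properties.Semiring.Mult semiring using (×-homo-+)
  open Algebra.Properties.Semiring.Sum semiring
    using (sum-syntax; sum-cong-≋; ∑-distrib-+)
  open Algebra.Solver.CommutativeMonoid +-commutativeMonoid using (solve; _⊕_; _⊜_)
  open Relation.Binary.Reasoning.Setoid setoid

  -- Finite sums in the ring.

  ∑-cong : ∀ m {f g : ℕ → Carrier} → (∀ k → f k ≈ g k) → ∑[ k < m ] f (toℕ k) ≈ ∑[ k < m ] g (toℕ k)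
  ∑-cong m f≈g = sum-cong-≋ {m} (f≈g ∘ toℕ)

  ∑-last : ∀ n (f : ℕ → Carrier) → ∑[ k ≤ n ] f (toℕ k) ≈ (∑[ k < n ] f (toℕ k)) + f n
  ∑-last zero    f = +-comm _ _
  ∑-last (suc n) f = trans (+-congˡ (∑-last n (f ∘ suc))) (sym (+-assoc _ _ _))

  ∑-evens : ∀ n (f : ℕ → Carrier) → (∀ k → f (suc (2 ℕ.* k)) ≈ 0#) →
            ∑[ k ≤ n ] f (toℕ k) ≈ ∑[ k ≤ ⌊ n /2⌋ ] f (2 ℕ.* toℕ k)
  ∑-evens zero          f odd = refl
  ∑-evens (suc zero)    f odd = +-congˡ (trans (+-congʳ (odd 0)) (+-identityˡ 0#))
  ∑-evens (suc (suc n)) f odd = +-congˡ (begin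
    f 1 + ∑[ k ≤ n ] f (suc (suc (toℕ k)))        ≈⟨ +-congʳ (odd 0) ⟩
    0# + ∑[ k ≤ n ] f (suc (suc (toℕ k)))         ≈⟨ +-identityˡ _ ⟩
    ∑[ k ≤ n ] f (suc (suc (toℕ k)))              ≈⟨ ∑-evens n (f ∘ suc ∘ suc) odd′ ⟩
    ∑[ k ≤ ⌊ n /2⌋ ] f (suc (suc (2 ℕ.* toℕ k)))  ≈⟨ ∑-cong (suc ⌊ n /2⌋) (λ k → reflexive (cong f (≡.sym (2*suc k)))) ⟩
    ∑[ k ≤ ⌊ n /2⌋ ] f (2 ℕ.* suc (toℕ k))        ∎)
    where
    odd′ : ∀ k → f (suc (suc (suc (2 ℕ.* k)))) ≈ 0#
    odd′ k = trans (reflexive (cong (f ∘ suc) (≡.sym (2*suc k)))) (odd (suc k))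

  -- The canonical map from the integers to the ring.

  fromℕ-homo-+ : ∀ m n → fromℕ (m ℕ.+ n) ≈ fromℕ m + fromℕ n
  fromℕ-homo-+ = ×-homo-+ 1#

  +-interchange : ∀ w x y z → (w + x) + (y + z) ≈ (w + y) + (x + z)
  +-interchange = solve 4 (λ w x y z → (w ⊕ x) ⊕ (y ⊕ z) ⊜ (w ⊕ y) ⊕ (x ⊕ z)) refl

  +-cancel-common : ∀ z x y → (z + x) - (z + y) ≈ x - y
  +-cancel-common z x y = begin
    (z + x) - (z + y)      ≈⟨ +-congˡ (⁻¹-∙-comm z y) ⟨
    (z + x) + (- z + - y)  ≈⟨ +-interchange _ _ _ _ ⟩
    (z - z) + (x - y)      ≈⟨ +-congʳ (-‿inverseʳ z) ⟩
    0# + (x - y)           ≈⟨ +-identityˡ _ ⟩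
    x - y                  ∎

  -- Integer addition with mixed signs computes to `⊖`, so this supplies the two mixed cases of
  -- `fromℤ-homo-+`.
  fromℤ-⊖ : ∀ m n → fromℤ (m ℤ.⊖ n) ≈ fromℕ m - fromℕ n
  fromℤ-⊖ m       zero    = sym (trans (+-congˡ ε⁻¹≈ε) (+-identityʳ _))
  fromℤ-⊖ zero    (suc n) = sym (+-identityˡ _)
  fromℤ-⊖ (suc m) (suc n) = begin
    fromℤ (suc m ℤ.⊖ suc n)            ≡⟨ cong fromℤ (ℤ.[1+m]⊖[1+n]≡m⊖n m n) ⟩
    fromℤ (m ℤ.⊖ n)                    ≈⟨ fromℤ-⊖ m n ⟩
    fromℕ m - fromℕ n                  ≈⟨ +-cancel-common 1# _ _ ⟨
    (1# + fromℕ m) - (1# + fromℕ n)    ∎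

  fromℤ-homo-+ : ∀ i j → fromℤ (i ℤ.+ j) ≈ fromℤ i + fromℤ j
  fromℤ-homo-+ (+ m)    (+ n)    = fromℕ-homo-+ m n
  fromℤ-homo-+ (+ m)    -[1+ n ] = fromℤ-⊖ m (suc n)
  fromℤ-homo-+ -[1+ m ] (+ n)    = trans (fromℤ-⊖ n (suc m)) (+-comm _ _)
  fromℤ-homo-+ -[1+ m ] -[1+ n ] = begin
    - fromℕ (suc (suc (m ℕ.+ n)))       ≡⟨ cong (-_ ∘ fromℕ ∘ suc) (ℕ.+-suc m n) ⟨
    - fromℕ (suc m ℕ.+ suc n)           ≈⟨ -‿cong (fromℕ-homo-+ (suc m) (suc n)) ⟩
    - (fromℕ (suc m) + fromℕ (suc n))   ≈⟨ ⁻¹-∙-comm _ _ ⟨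
    - fromℕ (suc m) - fromℕ (suc n)     ∎

  -- The factors inside the sum for `U` are binomial coefficients, so a natural left factor
  -- suffices; the outer factor -2 is turned into an addition in `u-rec`.
  fromℤ-homo-+* : ∀ n i → fromℤ (+ n ℤ.* i) ≈ fromℕ n * fromℤ i
  fromℤ-homo-+* zero    i = sym (zeroˡ _)
  fromℤ-homo-+* (suc n) i = begin
    fromℤ (+ suc n ℤ.* i)                    ≡⟨ cong fromℤ (ℤ.suc-* (+ n) i) ⟩
    fromℤ (i ℤ.+ + n ℤ.* i)                  ≈⟨ fromℤ-homo-+ i (+ n ℤ.* i) ⟩
    fromℤ i + fromℤ (+ n ℤ.* i)              ≈⟨ +-cong (sym (*-identityˡ _)) (fromℤ-homo-+* n i) ⟩
    1# * fromℤ i + fromℕ n * fromℤ i         ≈⟨ distribʳ _ _ _ ⟨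
    fromℕ (suc n) * fromℤ i                  ∎

  fromℤ-homo-∑ : ∀ m (f : ℕ → ℤ) → fromℤ (ℤΣ.sum-syntax m (f ∘ toℕ)) ≈ ∑[ k < m ] fromℤ (f (toℕ k))
  fromℤ-homo-∑ zero    f = refl
  fromℤ-homo-∑ (suc m) f = trans (fromℤ-homo-+ (f 0) _) (+-congˡ (fromℤ-homo-∑ m (f ∘ suc)))

  -- The algebra of binomial convolution.

  Seq : Set c
  Seq = ℕ → Carrier

  infix  4 _≋_
  infixl 6 _⊞_
  infixl 7 _⋆_
  infix  8 ⊟_

  _≋_ : Seq → Seq → Set ℓ
  a ≋ b = ∀ n → a n ≈ b n

  _⊞_ : Seq → Seq → Seq
  (a ⊞ b) n = a n + b n

  ⊟_ : Seq → Seq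
  (⊟ a) n = - a n

  pow : Carrier → Seq
  pow x n = x ^ n

  -- Binomial convolution, i.e. the product of exponential generating functions; the shift
  -- a ∘ suc is the derivative, so the second clause is the Leibniz rule.
  _⋆_ : Seq → Seq → Seq
  (a ⋆ b) zero    = a 0 * b 0
  (a ⋆ b) (suc n) = ((a ∘ suc) ⋆ b) n + (a ⋆ (b ∘ suc)) n

  ⋆-cong : ∀ {a a′ b b′} → a ≋ a′ → b ≋ b′ → a ⋆ b ≋ a′ ⋆ b′
  ⋆-cong a≋ b≋ zero    = *-cong (a≋ 0) (b≋ 0)
  ⋆-cong a≋ b≋ (suc n) = +-cong (⋆-cong (a≋ ∘ suc) b≋ n) (⋆-cong a≋ (b≋ ∘ suc) n)

  ⋆-congˡ : ∀ {a b b′} → b ≋ b′ → a ⋆ b ≋ a ⋆ b′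
  ⋆-congˡ = ⋆-cong (λ _ → refl)

  ⋆-congʳ : ∀ {a a′ b} → a ≋ a′ → a ⋆ b ≋ a′ ⋆ b
  ⋆-congʳ a≋ = ⋆-cong a≋ (λ _ → refl)

  ⋆-comm : ∀ a b → a ⋆ b ≋ b ⋆ a
  ⋆-comm a b zero    = *-comm _ _
  ⋆-comm a b (suc n) = trans (+-cong (⋆-comm (a ∘ suc) b n) (⋆-comm a (b ∘ suc) n)) (+-comm _ _)

  ⋆-distribˡ-⊞ : ∀ a b d → a ⋆ (b ⊞ d) ≋ a ⋆ b ⊞ a ⋆ d
  ⋆-distribˡ-⊞ a b d zero    = distribˡ _ _ _
  ⋆-distribˡ-⊞ a b d (suc n) = trans
    (+-cong (⋆-distribˡ-⊞ (a ∘ suc) b d n) (⋆-distribˡ-⊞ a (b ∘ suc) (d ∘ suc) n))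
    (+-interchange _ _ _ _)

  ⋆-distribʳ-⊞ : ∀ a b d → (b ⊞ d) ⋆ a ≋ b ⋆ a ⊞ d ⋆ a
  ⋆-distribʳ-⊞ a b d n = begin
    ((b ⊞ d) ⋆ a) n          ≈⟨ ⋆-comm (b ⊞ d) a n ⟩
    (a ⋆ (b ⊞ d)) n          ≈⟨ ⋆-distribˡ-⊞ a b d n ⟩
    (a ⋆ b) n + (a ⋆ d) n    ≈⟨ +-cong (⋆-comm a b n) (⋆-comm a d n) ⟩
    (b ⋆ a) n + (d ⋆ a) n    ∎

  ⋆-distribʳ-⊟ : ∀ a b → a ⋆ (⊟ b) ≋ ⊟ (a ⋆ b)
  ⋆-distribʳ-⊟ a b zero    = sym (-‿distribʳ-* _ _)
  ⋆-distribʳ-⊟ a b (suc n) = trans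
    (+-cong (⋆-distribʳ-⊟ (a ∘ suc) b n) (⋆-distribʳ-⊟ a (b ∘ suc) n)) (⁻¹-∙-comm _ _)

  ⋆-distribˡ-⊞⊟ : ∀ a b d → a ⋆ (b ⊞ ⊟ d) ≋ a ⋆ b ⊞ ⊟ (a ⋆ d)
  ⋆-distribˡ-⊞⊟ a b d n = trans (⋆-distribˡ-⊞ a b (⊟ d) n) (+-congˡ (⋆-distribʳ-⊟ a d n))

  ⋆-*-assoc : ∀ x a b n → ((λ k → x * a k) ⋆ b) n ≈ x * (a ⋆ b) n
  ⋆-*-assoc x a b zero    = *-assoc _ _ _
  ⋆-*-assoc x a b (suc n) = trans
    (+-cong (⋆-*-assoc x (a ∘ suc) b n) (⋆-*-assoc x a (b ∘ suc) n)) (sym (distribˡ _ _ _))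

  -- By the Leibniz rule both sides at `suc n` split into three terms, with the shift falling on
  -- `a`, `b` or `d`; these agree by induction.
  ⋆-assoc : ∀ a b d → (a ⋆ b) ⋆ d ≋ a ⋆ (b ⋆ d)
  ⋆-assoc a b d zero    = *-assoc _ _ _
  ⋆-assoc a b d (suc n) = begin
    (((a ∘ suc) ⋆ b ⊞ a ⋆ (b ∘ suc)) ⋆ d) n + (a ⋆ b ⋆ (d ∘ suc)) n
      ≈⟨ +-congʳ (⋆-distribʳ-⊞ d ((a ∘ suc) ⋆ b) (a ⋆ (b ∘ suc)) n) ⟩
    ((a ∘ suc) ⋆ b ⋆ d) n + (a ⋆ (b ∘ suc) ⋆ d) n + (a ⋆ b ⋆ (d ∘ suc)) n
      ≈⟨ +-cong (+-cong (⋆-assoc (a ∘ suc) b d n) (⋆-assoc a (b ∘ suc) d n)) (⋆-assoc a b (d ∘ suc) n) ⟩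
    ((a ∘ suc) ⋆ (b ⋆ d)) n + (a ⋆ ((b ∘ suc) ⋆ d)) n + (a ⋆ (b ⋆ (d ∘ suc))) n
      ≈⟨ +-assoc _ _ _ ⟩
    ((a ∘ suc) ⋆ (b ⋆ d)) n + ((a ⋆ ((b ∘ suc) ⋆ d)) n + (a ⋆ (b ⋆ (d ∘ suc))) n)
      ≈⟨ +-congˡ (⋆-distribˡ-⊞ a ((b ∘ suc) ⋆ d) (b ⋆ (d ∘ suc)) n) ⟨
    ((a ∘ suc) ⋆ (b ⋆ d)) n + (a ⋆ ((b ∘ suc) ⋆ d ⊞ b ⋆ (d ∘ suc))) n ∎

  -- The binomial theorem, as the product of two exponentials. Shifting `pow x` multiplies it by
  -- `x`, so each step of the convolution contributes a factor `x + y`.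
  pow-⋆ : ∀ x y → pow x ⋆ pow y ≋ pow (x + y)
  pow-⋆ x y zero    = *-identityˡ 1#
  pow-⋆ x y (suc n) = begin
    ((λ k → x * x ^ k) ⋆ pow y) n + (pow x ⋆ (λ k → y * y ^ k)) n
      ≈⟨ +-cong (⋆-*-assoc x (pow x) (pow y) n)
                (trans (⋆-comm (pow x) _ n) (trans (⋆-*-assoc y (pow y) (pow x) n) (*-congˡ (⋆-comm (pow y) (pow x) n)))) ⟩
    x * (pow x ⋆ pow y) n + y * (pow x ⋆ pow y) n  ≈⟨ distribʳ _ _ _ ⟨
    (x + y) * (pow x ⋆ pow y) n                    ≈⟨ *-congˡ (pow-⋆ x y n) ⟩
    (x + y) ^ suc n                                ∎

  pow-cong : ∀ {x y} → x ≈ y → pow x ≋ pow y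
  pow-cong x≈y zero    = refl
  pow-cong x≈y (suc n) = *-cong x≈y (pow-cong x≈y n)

  -- The Leibniz recursion corresponds to Pascal's rule: a shift on `a` moves the index up by one, a
  -- shift on `b` leaves it in place.
  ⋆-∑ : ∀ a b n → (a ⋆ b) n ≈ ∑[ k ≤ n ] (fromℕ (n C toℕ k) * (a (toℕ k) * b (n ℕ.∸ toℕ k)))
  ⋆-∑ a b zero    = sym (trans (+-identityʳ _) (trans (*-congʳ (+-identityʳ 1#)) (*-identityˡ _)))
  ⋆-∑ a b (suc n) = begin
    ((a ∘ suc) ⋆ b) n + (a ⋆ (b ∘ suc)) n
      ≈⟨ +-cong (⋆-∑ (a ∘ suc) b n) (⋆-∑ a (b ∘ suc) n) ⟩
    (∑[ k ≤ n ] p (toℕ k)) + (∑[ k ≤ n ] r (toℕ k))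
      -- Moving `suc` inside the truncated subtraction needs k ≤ n, which the range of the sum
      -- provides.
      ≈⟨ +-congˡ (sum-cong-≋ {suc n} λ k → *-congˡ {fromℕ (n C toℕ k)} (*-congˡ {a (toℕ k)}
           (reflexive (cong b (≡.sym (ℕ.+-∸-assoc 1 (ℕ.≤-pred (toℕ<n k)))))))) ⟩
    (∑[ k ≤ n ] p (toℕ k)) + (∑[ k ≤ n ] q (toℕ k))
      -- The second sum is extended by the term at `suc n`, zero because its binomial coefficient
      -- is; once its term at 0 is split off, both sums have the same length and pair up under
      -- Pascal's rule.
      ≈⟨ +-congˡ (+-identityʳ _) ⟨
    (∑[ k ≤ n ] p (toℕ k)) + ((∑[ k ≤ n ] q (toℕ k)) + 0#)
      ≈⟨ +-congˡ (+-congˡ (trans (*-congʳ (reflexive (cong fromℕ (k>n⇒nCk≡0 (ℕ.n<1+n n))))) (zeroˡ _))) ⟨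
    (∑[ k ≤ n ] p (toℕ k)) + ((∑[ k ≤ n ] q (toℕ k)) + q (suc n))
      ≈⟨ +-congˡ (∑-last (suc n) q) ⟨
    (∑[ k ≤ n ] p (toℕ k)) + (q 0 + (∑[ k ≤ n ] q (suc (toℕ k))))
      ≈⟨ solve 3 (λ x y z → x ⊕ (y ⊕ z) ⊜ y ⊕ (x ⊕ z)) refl _ _ _ ⟩
    q 0 + ((∑[ k ≤ n ] p (toℕ k)) + (∑[ k ≤ n ] q (suc (toℕ k))))
      ≈⟨ +-congˡ (∑-distrib-+ {suc n} (p ∘ toℕ) (q ∘ suc ∘ toℕ)) ⟨
    q 0 + (∑[ k ≤ n ] (p (toℕ k) + q (suc (toℕ k))))
      ≈⟨ +-congˡ (∑-cong (suc n) pascal) ⟩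
    t 0 + (∑[ k ≤ n ] t (suc (toℕ k))) ∎
    where
    p q r t : ℕ → Carrier
    p k = fromℕ (n C k) * (a (suc k) * b (n ℕ.∸ k))
    q k = fromℕ (n C k) * (a k * b (suc n ℕ.∸ k))
    r k = fromℕ (n C k) * (a k * b (suc (n ℕ.∸ k)))
    t k = fromℕ (suc n C k) * (a k * b (suc n ℕ.∸ k))
    pascal : ∀ k → p k + q (suc k) ≈ t (suc k)
    pascal k = begin
      p k + q (suc k)                          ≈⟨ distribʳ _ _ _ ⟨
      (fromℕ (n C k) + fromℕ (n C suc k)) * s  ≈⟨ *-congʳ (fromℕ-homo-+ (n C k) (n C suc k)) ⟨
      fromℕ (n C k ℕ.+ n C suc k) * s          ≡⟨ cong (λ m → fromℕ m * s) (nCk+nC[k+1]≡[n+1]C[k+1] n k) ⟩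
      t (suc k)                                ∎
      where s = a (suc k) * b (n ℕ.∸ k)

  -- The recursion for `U` as a convolution identity.

  u : Seq
  u n = fromℤ (U n)

  ∑-even-⋆ : ∀ a b → (∀ k → a (suc (2 ℕ.* k)) ≈ 0#) → ∀ n →
    (a ⋆ b) n ≈ ∑[ k ≤ ⌊ n /2⌋ ] (fromℕ (n C (2 ℕ.* toℕ k)) * (a (2 ℕ.* toℕ k) * b (n ℕ.∸ 2 ℕ.* toℕ k)))
  ∑-even-⋆ a b odd n = trans (⋆-∑ a b n)
    (∑-evens n (λ k → fromℕ (n C k) * (a k * b (n ℕ.∸ k)))
      λ k → trans (*-congˡ (trans (*-congʳ (odd k)) (zeroˡ _))) (zeroʳ _))

  -- Turns the sums of the theorem into convolutions: the odd-indexed terms missing from them vanish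
  -- by `U-odd`.
  ∑-U : ∀ b n →
    ∑[ k ≤ ⌊ n /2⌋ ] (fromℕ (n C (2 ℕ.* toℕ k)) * u (2 ℕ.* toℕ k) * b (n ℕ.∸ 2 ℕ.* toℕ k)) ≈ (u ⋆ b) n
  ∑-U b n = trans (∑-cong (suc ⌊ n /2⌋) λ k → *-assoc (fromℕ (n C (2 ℕ.* k))) (u (2 ℕ.* k)) (b (n ℕ.∸ 2 ℕ.* k)))
    (sym (∑-even-⋆ u b (λ k → reflexive (cong fromℤ (U-odd k))) n))

  u-rec : ∀ m → let n = suc m
                    s = ∑[ i < ⌊ n /2⌋ ] (fromℕ (n C (2 ℕ.* suc (toℕ i))) * u (n ℕ.∸ 2 ℕ.* suc (toℕ i)))
                in u n + (s + s) ≈ 0#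
  u-rec m = begin
    u n + (s + s)                            ≈⟨ +-congˡ (+-cong s≈ s≈) ⟨
    u n + (fromℤ S + fromℤ S)                ≈⟨ +-congˡ (fromℤ-homo-+ S S) ⟨
    u n + fromℤ (S ℤ.+ S)                    ≈⟨ fromℤ-homo-+ (U n) (S ℤ.+ S) ⟨
    fromℤ (U n ℤ.+ (S ℤ.+ S))                ≡⟨ cong fromℤ ℤ-rec ⟩
    0#                                       ∎
    where
    n = suc m
    f : ℕ → ℤ
    f i = + (n C (2 ℕ.* suc i)) ℤ.* U (n ℕ.∸ 2 ℕ.* suc i)
    S = ℤΣ.sum-syntax ⌊ n /2⌋ (f ∘ toℕ)
    s = ∑[ i < ⌊ n /2⌋ ] (fromℕ (n C (2 ℕ.* suc (toℕ i))) * u (n ℕ.∸ 2 ℕ.* suc (toℕ i)))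
    s≈ : fromℤ S ≈ s
    s≈ = trans (fromℤ-homo-∑ ⌊ n /2⌋ f)
      (∑-cong ⌊ n /2⌋ λ i → fromℤ-homo-+* (n C (2 ℕ.* suc i)) (U (n ℕ.∸ 2 ℕ.* suc i)))
    -- Doubling becomes addition, which `fromℤ` respects.
    2S : + 2 ℤ.* S ≡ S ℤ.+ S
    2S = ≡.trans (ℤ.suc-* (+ 1) S) (cong (λ i → S ℤ.+ i) (ℤ.*-identityˡ S))
    ℤ-rec : U n ℤ.+ (S ℤ.+ S) ≡ 0ℤ
    ℤ-rec = ≡.trans (≡.cong₂ ℤ._+_ (≡.trans (U-suc m) (≡.sym (ℤ.neg-distribˡ-* (+ 2) S))) (≡.sym 2S))
      (ℤ.+-inverseˡ (+ 2 ℤ.* S))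

  -- The coefficients of 2 cosh t: 2 at even indices, 0 at odd ones.
  g : Seq
  g = pow (- 1#) ⊞ pow 1#

  g-periodic : ∀ n → g (suc (suc n)) ≈ g n
  g-periodic n = +-cong
    (trans (-1*x≈-x _) (trans (-‿cong (-1*x≈-x _)) (⁻¹-involutive _)))
    (trans (*-identityˡ _) (*-identityˡ _))

  g-even : ∀ k → g (2 ℕ.* k) ≈ 1# + 1#
  g-even zero    = refl
  g-even (suc k) = trans (reflexive (cong g (2*suc k))) (trans (g-periodic (2 ℕ.* k)) (g-even k))

  g-odd : ∀ k → g (suc (2 ℕ.* k)) ≈ 0#
  g-odd zero    = trans (+-cong (*-identityʳ _) (*-identityʳ _)) (-‿inverseˡ 1#)
  g-odd (suc k) = trans (reflexive (cong (g ∘ suc) (2*suc k))) (trans (g-periodic (suc (2 ℕ.* k))) (g-odd k))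

  [1+1]*x≈x+x : ∀ x → (1# + 1#) * x ≈ x + x
  [1+1]*x≈x+x x = trans (distribʳ _ _ _) (+-cong (*-identityˡ x) (*-identityˡ x))

  fromℕ1*x≈x : ∀ x → fromℕ 1 * x ≈ x
  fromℕ1*x≈x x = trans (*-congʳ (+-identityʳ 1#)) (*-identityˡ x)

  -- In generating functions, U(t) · 2 cosh t = 1 + U(t), that is, U(t) = 1 / (2 cosh t - 1). Since
  -- 0^0 = 1, `pow 0#` is the constant 1.
  u⋆g : u ⋆ g ≋ pow 0# ⊞ u
  u⋆g zero    = trans (*-congʳ (+-identityʳ 1#)) (trans (*-identityˡ _) (+-congˡ (sym (+-identityʳ 1#))))
  u⋆g (suc m) = begin
    -- With `g` on the left, 2k indexes `g` and n - 2k indexes `u`, as in the recursion.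
    (u ⋆ g) n                                  ≈⟨ ⋆-comm u g n ⟩
    (g ⋆ u) n                                  ≈⟨ ∑-even-⋆ g u g-odd n ⟩
    ∑[ k ≤ ⌊ n /2⌋ ] (fromℕ (n C (2 ℕ.* toℕ k)) * (g (2 ℕ.* toℕ k) * u (n ℕ.∸ 2 ℕ.* toℕ k)))
      ≈⟨ ∑-cong (suc ⌊ n /2⌋) (λ k → double (fromℕ (n C (2 ℕ.* k))) (g-even k) (u (n ℕ.∸ 2 ℕ.* k))) ⟩
    ∑[ k ≤ ⌊ n /2⌋ ] (h (toℕ k) + h (toℕ k))   ≈⟨ ∑-distrib-+ {suc ⌊ n /2⌋} (h ∘ toℕ) (h ∘ toℕ) ⟩
    -- The term k = 0 gives `u n` twice; one copy cancels against `s + s` by the recursion.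
    (h 0 + s) + (h 0 + s)                      ≈⟨ +-cong (+-congʳ (fromℕ1*x≈x _)) (+-congʳ (fromℕ1*x≈x _)) ⟩
    (u n + s) + (u n + s)                      ≈⟨ solve 2 (λ x y → (x ⊕ y) ⊕ (x ⊕ y) ⊜ (x ⊕ (y ⊕ y)) ⊕ x) refl (u n) s ⟩
    (u n + (s + s)) + u n                      ≈⟨ +-congʳ (u-rec m) ⟩
    0# + u n                                   ≈⟨ +-congʳ (zeroˡ (0# ^ m)) ⟨
    0# ^ n + u n                               ∎
    where
    n = suc m
    h : Seq
    h k = fromℕ (n C (2 ℕ.* k)) * u (n ℕ.∸ 2 ℕ.* k)
    s = ∑[ k < ⌊ n /2⌋ ] h (suc (toℕ k))
    double : ∀ x {y} → y ≈ 1# + 1# → ∀ z → x * (y * z) ≈ x * z + x * z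
    double x y≈2 z = trans (*-congˡ (trans (*-congʳ y≈2) ([1+1]*x≈x+x z))) (distribˡ _ _ _)

  -- Translates of `F` and the three identities.

  F : ℕ → Carrier → Carrier
  F n x = (u ⋆ pow x) n

  F-cong : ∀ n {x y} → x ≈ y → F n x ≈ F n y
  F-cong n x≈y = ⋆-congˡ {u} (pow-cong x≈y) n

  -- By `pow-⋆` the two translated powers add up to `g ⋆ pow x`; associativity then brings `g` next
  -- to `u`, where `u⋆g` applies.
  F-rec : ∀ n x → F n (x - 1#) + F n (x + 1#) ≈ x ^ n + F n x
  F-rec n x = begin
    F n (x - 1#) + F n (x + 1#)                ≈⟨ ⋆-distribˡ-⊞ u (pow (x - 1#)) (pow (x + 1#)) n ⟨
    (u ⋆ (pow (x - 1#) ⊞ pow (x + 1#))) n      ≈⟨ ⋆-congˡ {u} (λ k → +-cong (shift (- 1#) k) (shift 1# k)) n ⟩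
    (u ⋆ (pow (- 1#) ⋆ pow x ⊞ pow 1# ⋆ pow x)) n ≈⟨ ⋆-congˡ {u} (⋆-distribʳ-⊞ (pow x) (pow (- 1#)) (pow 1#)) n ⟨
    (u ⋆ (g ⋆ pow x)) n                        ≈⟨ ⋆-assoc u g (pow x) n ⟨
    (u ⋆ g ⋆ pow x) n                          ≈⟨ ⋆-congʳ {b = pow x} u⋆g n ⟩
    ((pow 0# ⊞ u) ⋆ pow x) n                   ≈⟨ ⋆-distribʳ-⊞ (pow x) (pow 0#) u n ⟩
    (pow 0# ⋆ pow x) n + F n x                 ≈⟨ +-congʳ (trans (pow-⋆ 0# x n) (pow-cong (+-identityˡ x) n)) ⟩
    x ^ n + F n x                              ∎
    where
    shift : ∀ y → pow (x + y) ≋ pow y ⋆ pow x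
    shift y k = sym (trans (pow-⋆ y x k) (pow-cong (+-comm y x) k))

  F-span-3 : ∀ n x → F n x + F n (x + fromℕ 3) ≈ (x + 1#) ^ n + (x + fromℕ 2) ^ n
  -- `F₀ + F₂` and `F₁ + F₃` are the left sides of `F-rec` centred at x + 1 and x + 2, so the inner
  -- values occur on both sides.
  F-span-3 n x = +-cancelʳ (F₁ + F₂) _ _ (begin
    (F₀ + F₃) + (F₁ + F₂)   ≈⟨ solve 4 (λ a b c d → (a ⊕ d) ⊕ (b ⊕ c) ⊜ (a ⊕ c) ⊕ (b ⊕ d)) refl F₀ F₁ F₂ F₃ ⟩
    (F₀ + F₂) + (F₁ + F₃)   ≈⟨ +-cong
      (trans (+-cong (F-cong n (sym (//-rightDividesʳ 1# x))) (F-cong n (sym (shift 1#≈fromℕ1)))) (F-rec n (x + 1#)))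
      (trans (+-cong (F-cong n (sym pred)) (F-cong n (sym (shift refl)))) (F-rec n (x + fromℕ 2))) ⟩
    (x₁ + F₁) + (x₂ + F₂)   ≈⟨ +-interchange _ _ _ _ ⟩
    (x₁ + x₂) + (F₁ + F₂)   ∎)
    where
    F₀ = F n x
    F₁ = F n (x + 1#)
    F₂ = F n (x + fromℕ 2)
    F₃ = F n (x + fromℕ 3)
    x₁ = (x + 1#) ^ n
    x₂ = (x + fromℕ 2) ^ n
    -- `fromℕ 1` unfolds to `1# + 0#`, so the bare `1#` has to be converted.
    1#≈fromℕ1 : 1# ≈ fromℕ 1
    1#≈fromℕ1 = sym (+-identityʳ 1#)
    shift : ∀ {y z} → y ≈ z → (x + y) + 1# ≈ x + (1# + z)
    shift y≈z = trans (+-assoc _ _ _) (+-congˡ (trans (+-comm _ _) (+-congˡ y≈z)))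
    pred : (x + fromℕ 2) - 1# ≈ x + 1#
    pred = trans (+-congʳ (sym (shift 1#≈fromℕ1))) (//-rightDividesʳ 1# (x + 1#))

  ⋆-second-difference : ∀ n x → (u ⋆ (λ m → (x - 1#) ^ m - x ^ m + (x + 1#) ^ m)) n ≈ x ^ n
  ⋆-second-difference n x = begin
    (u ⋆ (pow (x - 1#) ⊞ ⊟ pow x ⊞ pow (x + 1#))) n
      ≈⟨ ⋆-distribˡ-⊞ u (pow (x - 1#) ⊞ ⊟ pow x) (pow (x + 1#)) n ⟩
    (u ⋆ (pow (x - 1#) ⊞ ⊟ pow x)) n + F n (x + 1#)
      ≈⟨ +-congʳ (⋆-distribˡ-⊞⊟ u (pow (x - 1#)) (pow x) n) ⟩
    (F n (x - 1#) - F n x) + F n (x + 1#)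
      ≈⟨ solve 3 (λ a b c → (a ⊕ b) ⊕ c ⊜ (a ⊕ c) ⊕ b) refl _ _ _ ⟩
    (F n (x - 1#) + F n (x + 1#)) - F n x  ≈⟨ +-congʳ (F-rec n x) ⟩
    (x ^ n + F n x) - F n x                ≈⟨ //-rightDividesʳ _ _ ⟩
    x ^ n                                  ∎

  -- Serves to simplify (x - 3) + 1 and (x - 3) + 2, with 3 split as 1 + 2 and as 2 + 1.
  x-[y+z]+y≈x-z : ∀ x y z → (x - (y + z)) + y ≈ x - z
  x-[y+z]+y≈x-z x y z = begin
    (x - (y + z)) + y        ≈⟨ +-congʳ (+-congˡ (⁻¹-anti-homo-∙ y z)) ⟩
    (x + (- z - y)) + y      ≈⟨ +-congʳ (+-assoc x (- z) (- y)) ⟨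
    ((x - z) - y) + y        ≈⟨ //-rightDividesˡ y (x - z) ⟩
    x - z                    ∎

  F-span-6 : ∀ n x → F n (x + fromℕ 3) - F n (x - fromℕ 3)
    ≈ (x + fromℕ 2) ^ n + (x + 1#) ^ n - (x - 1#) ^ n - (x - fromℕ 2) ^ n
  F-span-6 n x = begin
    F n (x + fromℕ 3) - F n (x - fromℕ 3)
      -- `F n x` is inserted as the shared endpoint of the spans from x - 3 to x and from x to x +
      -- 3.
      ≈⟨ +-cancel-common (F n x) _ _ ⟨
    (F n x + F n (x + fromℕ 3)) - (F n x + F n (x - fromℕ 3))
      ≈⟨ +-cong (F-span-3 n x) (-‿cong left) ⟩
    ((x + 1#) ^ n + (x + fromℕ 2) ^ n) - ((x - fromℕ 2) ^ n + (x - 1#) ^ n)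
      ≈⟨ +-cong (+-comm _ _) (⁻¹-anti-homo-∙ _ _) ⟩
    ((x + fromℕ 2) ^ n + (x + 1#) ^ n) + (- (x - 1#) ^ n - (x - fromℕ 2) ^ n)
      ≈⟨ +-assoc _ _ _ ⟨
    (x + fromℕ 2) ^ n + (x + 1#) ^ n - (x - 1#) ^ n - (x - fromℕ 2) ^ n ∎
    where
    left : F n x + F n (x - fromℕ 3) ≈ (x - fromℕ 2) ^ n + (x - 1#) ^ n
    left = begin
      F n x + F n (x - fromℕ 3)
        ≈⟨ +-comm _ _ ⟩
      F n (x - fromℕ 3) + F n x
        ≈⟨ +-congˡ (F-cong n (//-rightDividesˡ (fromℕ 3) x)) ⟨
      F n (x - fromℕ 3) + F n ((x - fromℕ 3) + fromℕ 3)
        ≈⟨ F-span-3 n (x - fromℕ 3) ⟩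
      ((x - fromℕ 3) + 1#) ^ n + ((x - fromℕ 3) + fromℕ 2) ^ n
        ≈⟨ +-cong (pow-cong (x-[y+z]+y≈x-z x 1# (fromℕ 2)) n)
                  -- `fromℕ 3` unfolds to `1# + fromℕ 2`; the summands are swapped so that the 2 can
                  -- cancel.
                  (pow-cong (trans (+-congʳ (+-congˡ (-‿cong (+-comm 1# (fromℕ 2)))))
                                   (x-[y+z]+y≈x-z x (fromℕ 2) 1#)) n) ⟩
      (x - fromℕ 2) ^ n + (x - 1#) ^ n ∎

theorem2p3 :
  ∀ {c ℓ} (R : CommutativeRing c ℓ) →
  let open CommutativeRing R
      open InRing R
  in
  (n : ℕ) (x : Carrier) →
    ((∑[ k ≤ ⌊ n /2⌋ ]
        (fromℕ (n C (2 ℕ.* toℕ k)) * fromℤ (U (2 ℕ.* toℕ k)) *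
          ((x - 1#) ^ (n ℕ.∸ 2 ℕ.* toℕ k) - x ^ (n ℕ.∸ 2 ℕ.* toℕ k)
            + (x + 1#) ^ (n ℕ.∸ 2 ℕ.* toℕ k))))
      ≈ x ^ n)
    ×
    ((∑[ k ≤ ⌊ n /2⌋ ]
        (fromℕ (n C (2 ℕ.* toℕ k)) * fromℤ (U (2 ℕ.* toℕ k)) *
          (x ^ (n ℕ.∸ 2 ℕ.* toℕ k) + (x + fromℕ 3) ^ (n ℕ.∸ 2 ℕ.* toℕ k))))
      ≈ (x + 1#) ^ n + (x + fromℕ 2) ^ n)
    ×
    ((∑[ k ≤ ⌊ n /2⌋ ]
        (fromℕ (n C (2 ℕ.* toℕ k)) * fromℤ (U (2 ℕ.* toℕ k)) *
          ((x + fromℕ 3) ^ (n ℕ.∸ 2 ℕ.* toℕ k) - (x - fromℕ 3) ^ (n ℕ.∸ 2 ℕ.* toℕ k))))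
      ≈ (x + fromℕ 2) ^ n + (x + 1#) ^ n - (x - 1#) ^ n - (x - fromℕ 2) ^ n)
theorem2p3 R n x =
    trans (∑-U R (λ m → (x - 1#) ^ m - x ^ m + (x + 1#) ^ m) n) (⋆-second-difference R n x)
  , trans (∑-U R (λ m → x ^ m + (x + fromℕ 3) ^ m) n)
      (trans (⋆-distribˡ-⊞ R (u R) (pow R x) (pow R (x + fromℕ 3)) n) (F-span-3 R n x))
  , trans (∑-U R (λ m → (x + fromℕ 3) ^ m - (x - fromℕ 3) ^ m) n)
      (trans (⋆-distribˡ-⊞⊟ R (u R) (pow R (x + fromℕ 3)) (pow R (x - fromℕ 3)) n) (F-span-6 R n x))
  where
  open CommutativeRing R
  open InRing R
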